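{- For every integer $n\ge 3$, the achievement number of the path $P_n$ on $n$ vertices satisfies $$a(P_n)=\begin{cases}3, & n=3;\\ 5, & n=4;\\ n, & n\ge 5.\end{cases}$$
   Context: For a finite graph $G$ with no isolated vertices, the achievement game of $G$ on $K_N$ is played by Alice and Bob on the edges of the complete graph $K_N$, all initially uncolored: in each round Alice first colors one uncolored edge blue, then Bob colors one uncolored edge red. The player who first completes a copy of $G$ entirely in his or her own color wins; otherwise the game is a draw. The achievement number $a(G)$ is the smallest $N$ for which Alice has a winning strategy in this game on $K_N$. -}

module Defs where

open import Data.Nat using (ℕ; zero; suc; _≤_; _<_)
open import Data.Fin using (Fin; toℕ)
open import Data.Product using (_×_; _,_; Σ; ∃; ∃-syntax)
open import Data.Sum using (_⊎_)
open import Data.List using (List; []; _∷_)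
open import Data.List.Membership.Propositional using (_∈_)
open import Relation.Binary.PropositionalEquality using (_≡_; _≢_)
open import Relation.Nullary using (¬_)
open import Function.Definitions using (Injective)

record Graph : Set₁ where
  field
    order : ℕ
    Adj   : Fin order → Fin order → Set
open Graph public

Path : ℕ → Graph
Path n = record
  { order = n
  ; Adj   = λ i j → (toℕ j ≡ suc (toℕ i)) ⊎ (toℕ i ≡ suc (toℕ j)) }

-- An edge of K_N, recorded as an ordered pair of its endpoints;
-- a colour class is the list of edges coloured so far in that colour.
Edge : ℕ → Set
Edge N = Fin N × Fin N

Colored : ∀ {N} → List (Edge N) → Fin N → Fin N → Set
Colored L u v = ((u , v) ∈ L) ⊎ ((v , u) ∈ L)

Uncolored : ∀ {N} → List (Edge N) → List (Edge N) → Fin N → Fin N → Set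
Uncolored B R u v = (u ≢ v) × ¬ Colored B u v × ¬ Colored R u v

HasCopy : (G : Graph) → ∀ {N} → List (Edge N) → Set
HasCopy G {N} L =
  Σ (Fin (order G) → Fin N) λ f →
    Injective _≡_ _≡_ f × (∀ u v → Adj G u v → Colored L (f u) (f v))

-- AliceWins G B R : in the achievement game of G on K_N, in the position with
-- blue edges B and red edges R, with Alice to move and nobody having won yet,
-- Alice has a winning strategy.  (Inductive = well-founded game tree, i.e. a
-- winning strategy in this finite game.)  Alice picks an uncoloured edge {u,v};
-- either the blue class now contains a copy of G (she wins), or Bob still has an
-- uncoloured edge to colour (otherwise the game is a draw) and for every Bob move
-- {x,y} the red class does not contain a copy of G and Alice wins from there.
data AliceWins (G : Graph) {N : ℕ} : List (Edge N) → List (Edge N) → Set where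
  move : ∀ {B R} (u v : Fin N) → Uncolored B R u v →
         HasCopy G ((u , v) ∷ B)
         ⊎ ( (∃[ x ] ∃[ y ] Uncolored ((u , v) ∷ B) R x y)
           × (∀ x y → Uncolored ((u , v) ∷ B) R x y →
                ¬ HasCopy G ((x , y) ∷ R)
                × AliceWins G ((u , v) ∷ B) ((x , y) ∷ R)) ) →
         AliceWins G B R

AliceWinsOn : Graph → ℕ → Set
AliceWinsOn G N = AliceWins G {N} [] []

AchievementNumberIs : Graph → ℕ → Set
AchievementNumberIs G k = AliceWinsOn G k × (∀ N → N < k → ¬ AliceWinsOn G N)

-- For n ≥ 5 Alice builds her path in n - 1 moves, so Bob never has enough edges to come
-- first. She keeps one blue path and isolated vertices such that at most two red edges
-- still matter, one of them at an end of the path. Extending from that end makes this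
-- edge irrelevant, and the new vertex can be chosen so that the other one then touches an
-- end or is irrelevant too; Bob adds one edge. With three vertices left she joins two of
-- them, then the third to this pair or to the path, so that at most three red edges block
-- the four edges joining the ends of the last two strands.
-- On K₄ Bob draws against P₄ by always answering with the opposite edge.
module Submission where

open import Defs
open import Data.Nat using (ℕ; zero; suc; _+_; _*_; _≤_; _<_; s≤s; z≤n)
open import Data.Nat.Properties
  using ( m+[n∸m]≡n; m≤n⇒m<n∨m≡n; m≤m+n; m≤n+m; m≢1+n+m; +-monoʳ-≤; +-assoc; +-comm; +-suc
        ; +-identityʳ; ≤-refl; ≤-trans; ≤-reflexive; <⇒≱; suc-injective)
open import Data.Fin using (Fin; zero; suc; toℕ; inject₁; remQuot; combine; _≟_)
open import Data.Fin.Properties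
  using (injective⇒≤; inject₁-injective; toℕ-inject₁; combine-remQuot; ¬∀⟶∃¬)
open import Data.Product using (_×_; _,_; Σ; ∃; ∃-syntax; ∃₂; proj₁; proj₂)
open import Data.Product.Properties using (≡-dec)
open import Data.Sum using (_⊎_; inj₁; inj₂; swap) renaming ([_,_] to either)
open import Data.List using (List; []; _∷_; [_]; _++_; length; lookup; map; reverse; allFin; tabulate)
open import Data.List.Properties using (length-++; length-reverse; length-tabulate; unfold-reverse)
open import Data.List.Membership.Propositional using (_∈_; _∉_)
open import Data.List.Membership.Propositional.Properties using (∈-∃++; ∈-++⁻; ∈-lookup)
open import Data.List.Relation.Unary.Any as Any using (here; there)
open import Data.List.Relation.Unary.Any.Properties using (lookup-index; reverse⁻)
open import Data.List.Relation.Unary.All as All using (All; []; _∷_)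
import Data.List.Relation.Unary.All.Properties as All
open import Data.List.Relation.Unary.AllPairs as AllPairs using (AllPairs; []; _∷_)
import Data.List.Relation.Unary.AllPairs.Properties as AllPairs
open import Data.List.Relation.Unary.Unique.Propositional using (Unique)
import Data.List.Relation.Unary.Unique.Propositional.Properties as Unique
open import Data.List.Relation.Binary.Disjoint.Propositional using (Disjoint)
open import Data.List.Relation.Binary.Permutation.Propositional
  using (_↭_; ↭-refl; ↭-reflexive; ↭-prep; ↭-swap; ↭-trans; ↭-sym; ↭⇒↭ₛ)
open import Data.List.Relation.Binary.Permutation.Propositional.Properties
  using (All-resp-↭; ∈-resp-↭; ↭-length; ↭-reverse; shift; map⁺)
import Data.List.Relation.Binary.Permutation.Setoid.Properties as Setoid
open import Function using (_∘_; id)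
open import Relation.Binary.PropositionalEquality
  using (_≡_; _≢_; refl; sym; trans; cong; cong₂; subst; setoid; ≢-sym)
open import Relation.Nullary using (¬_; Dec; yes; no; contradiction; ¬?)
open import Relation.Nullary.Decidable using (_×-dec_; _⊎-dec_; decidable-stable)

private
  variable
    N n k : ℕ
    B R E L : List (Edge N)
    a b c d s t u v : Fin N
    P Q S T U : List (Fin N)

-- Edges as unordered pairs, and counting coloured ones

_≈_ : Edge N → Edge N → Set
(a , b) ≈ (c , d) = (a ≡ c × b ≡ d) ⊎ (a ≡ d × b ≡ c)

-- Symmetry and transitivity in one: edges are mostly compared through a third edge that both of
-- them match.
≈-common : {e f g : Edge N} → e ≈ g → f ≈ g → e ≈ f
≈-common (inj₁ (refl , refl)) (inj₁ (refl , refl)) = inj₁ (refl , refl)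
≈-common (inj₁ (refl , refl)) (inj₂ (refl , refl)) = inj₂ (refl , refl)
≈-common (inj₂ (refl , refl)) (inj₁ (refl , refl)) = inj₂ (refl , refl)
≈-common (inj₂ (refl , refl)) (inj₂ (refl , refl)) = inj₁ (refl , refl)

≈-sym : {e f : Edge N} → e ≈ f → f ≈ e
≈-sym = ≈-common (inj₁ (refl , refl))

≈-flip : {e : Edge N} → (s , t) ≈ e → (t , s) ≈ e
≈-flip (inj₁ (s≡c , t≡d)) = inj₂ (t≡d , s≡c)
≈-flip (inj₂ (s≡d , t≡c)) = inj₁ (t≡c , s≡d)

colored? : ∀ (L : List (Edge N)) u v → Dec (Colored L u v)
colored? L u v = (u , v) ∈? L ⊎-dec (v , u) ∈? L
  where open import Data.List.Membership.DecPropositional (≡-dec _≟_ _≟_) using (_∈?_)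

colored-here : ∀ {e} → (u , v) ≈ e → Colored (e ∷ L) u v
colored-here (inj₁ (refl , refl)) = inj₁ (here refl)
colored-here (inj₂ (refl , refl)) = inj₂ (here refl)

colored-there : ∀ {e} → Colored L u v → Colored (e ∷ L) u v
colored-there (inj₁ p) = inj₁ (there p)
colored-there (inj₂ p) = inj₂ (there p)

colored-∷⁻ : ∀ {e} → Colored (e ∷ L) u v → (u , v) ≈ e ⊎ Colored L u v
colored-∷⁻ (inj₁ (here refl)) = inj₁ (inj₁ (refl , refl))
colored-∷⁻ (inj₁ (there p))   = inj₂ (inj₁ p)
colored-∷⁻ (inj₂ (here refl)) = inj₁ (inj₂ (refl , refl))
colored-∷⁻ (inj₂ (there p))   = inj₂ (inj₂ p)

colored-mono : ∀ {e} → (Colored L u v → Colored E u v) → Colored (e ∷ L) u v → Colored (e ∷ E) u v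
colored-mono f col = either colored-here (colored-there ∘ f) (colored-∷⁻ col)

colored-index : Colored L u v → Σ (Fin (length L)) λ i → (u , v) ≈ lookup L i
colored-index (inj₁ p) = Any.index p , inj₁ (cong proj₁ (lookup-index p) , cong proj₂ (lookup-index p))
colored-index (inj₂ p) = Any.index p , inj₂ (cong proj₂ (lookup-index p) , cong proj₁ (lookup-index p))

-- Each edge is sent to the position of a list entry that it matches, and two edges with the same
-- position match each other. Repeated or reversed entries of `L` do no harm.
distinct-colored-≤ : (e : Fin k → Edge N) → (∀ {i j} → e i ≈ e j → i ≡ j) →
                     (∀ i → Colored L (proj₁ (e i)) (proj₂ (e i))) → k ≤ length L
distinct-colored-≤ {L = L} e e-inj col = injective⇒≤ {f = proj₁ ∘ index} λ {i} {j} eq →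
  e-inj (≈-common (proj₂ (index i)) (subst (λ x → e j ≈ lookup L x) (sym eq) (proj₂ (index j))))
  where
  index : ∀ i → Σ (Fin (length L)) λ x → e i ≈ lookup L x
  index i = colored-index (col i)

unique-lookup-injective : Unique S → ∀ i j → lookup S i ≡ lookup S j → i ≡ j
unique-lookup-injective (x ∷ xs) zero    zero    eq = refl
unique-lookup-injective (x ∷ xs) zero    (suc j) eq = contradiction eq (All.lookup x (∈-lookup j))
unique-lookup-injective (x ∷ xs) (suc i) zero    eq = contradiction (sym eq) (All.lookup x (∈-lookup i))
unique-lookup-injective (x ∷ xs) (suc i) (suc j) eq = cong suc (unique-lookup-injective xs i j eq)

-- Since `S` and `T` are disjoint, the `length S * length T` crossing pairs are distinct even as
-- unordered edges, so the shorter list `E` misses one. This is how Alice finds an edge that Bob has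
-- not blocked.
uncolored-crossing : ∀ (E : List (Edge N)) → Unique S → Unique T → Disjoint S T →
                     length E < length S * length T →
                     ∃₂ λ s t → s ∈ S × t ∈ T × ¬ Colored E s t
uncolored-crossing {S = S} {T = T} E S! T! disj E< =
  let i , ¬col = ¬∀⟶∃¬ _ (λ i → Colored E (left i) (right i)) (λ i → colored? E (left i) (right i))
                   (λ col → <⇒≱ E< (distinct-colored-≤ (λ i → left i , right i) inj col))
  in left i , right i , ∈-lookup _ , ∈-lookup _ , ¬col
  where
  split : Fin (length S * length T) → Fin (length S) × Fin (length T)
  split = remQuot (length T)
  left right : Fin (length S * length T) → Fin _
  left  i = lookup S (proj₁ (split i))
  right i = lookup T (proj₂ (split i))
  inj : ∀ {i j} → (left i , right i) ≈ (left j , right j) → i ≡ j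
  inj {i} {j} (inj₁ (p , q)) =
    trans (sym (combine-remQuot {length S} (length T) i))
      (trans (cong₂ combine (unique-lookup-injective S! _ _ p) (unique-lookup-injective T! _ _ q))
        (combine-remQuot {length S} (length T) j))
  inj {i} {j} (inj₂ (p , _)) =
    contradiction (∈-lookup _ , subst (_∈ T) (sym p) (∈-lookup _)) disj

-- The `n - 1` edges of the path are distinct, and each needs its own entry. In `play` the bound
-- `3 + length R ≤ n` thus leaves Bob short of a copy even after his reply.
copy-size : HasCopy (Path n) L → n ≤ suc (length L)
copy-size {n = zero}  _ = z≤n
copy-size {n = suc n} (f , f-inj , adj) = s≤s (distinct-colored-≤ (λ i → f (inject₁ i) , f (suc i)) inj
  λ i → adj (inject₁ i) (suc i) (inj₁ (cong suc (sym (toℕ-inject₁ i)))))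
  where
  inj : ∀ {i j : Fin n} → (f (inject₁ i) , f (suc i)) ≈ (f (inject₁ j) , f (suc j)) → i ≡ j
  inj (inj₁ (p , _)) = inject₁-injective (f-inj p)
  -- Two path edges that agree in reverse would give `toℕ j ≡ 2 + toℕ j`.
  inj {i} {j} (inj₂ (p , q)) = contradiction
    (trans (sym (toℕ-inject₁ j)) (trans (cong toℕ (sym (f-inj q)))
      (cong suc (trans (sym (toℕ-inject₁ i)) (cong toℕ (f-inj p))))))
    (m≢1+n+m (toℕ j) {1})

wins⇒copy : ∀ {G} {B R : List (Edge N)} → AliceWins G B R → ∃ λ L → HasCopy G {N} L
wins⇒copy (move u v _ (inj₁ copy)) = _ , copy
-- The strategy itself supplies a legal reply of Bob, so one branch can be followed down to a
-- finished copy.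
wins⇒copy (move u v _ (inj₂ ((x , y , free) , next))) = wins⇒copy (proj₂ (next x y free))

¬wins-small : N < n → ¬ AliceWinsOn (Path n) N
¬wins-small N<n win = let _ , f , f-inj , _ = wins⇒copy win in <⇒≱ N<n (injective⇒≤ f-inj)

-- The continuation is required for every pair x y, legal or not: the winning move
-- against the reply (u , v), which changes nothing, then shows that Bob is not stuck.
play : ∀ u v → Uncolored B R u v → 3 + length R ≤ n →
       (∀ x y → AliceWins (Path n) ((u , v) ∷ B) ((x , y) ∷ R)) → AliceWins (Path n) B R
play {B = B} {R = R} u v free short next = move u v free (inj₂ (stuck (next u v) , λ x y _ →
  (λ copy → <⇒≱ short (copy-size copy)) , next x y))
  where
  stuck : AliceWins _ ((u , v) ∷ B) ((u , v) ∷ R) → ∃[ x ] ∃[ y ] Uncolored ((u , v) ∷ B) R x y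
  stuck (move x y (x≢y , ¬blue , ¬red) _) = x , y , x≢y , ¬blue , ¬red ∘ colored-there

-- Blue paths as vertex lists

data Walk (B : List (Edge N)) : Fin N → Fin N → List (Fin N) → Set where
  stay : Walk B a a [ a ]
  step : Colored B a b → Walk B b c P → Walk B a c (a ∷ P)

colored-sym : Colored L u v → Colored L v u
colored-sym = swap

walk-∷ : ∀ {e} → Walk B a b P → Walk (e ∷ B) a b P
walk-∷ stay       = stay
walk-∷ (step e w) = step (colored-there e) (walk-∷ w)

walk-++ : Walk B a b P → Colored B b c → Walk B c d Q → Walk B a d (P ++ Q)
walk-++ stay       e w′ = step e w′
walk-++ (step f w) e w′ = step f (walk-++ w e w′)

walk-reverse : Walk B a b P → Walk B b a (reverse P)
walk-reverse stay = stay
walk-reverse {b = b} (step {a = a} {P = P} e w) =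
  subst (Walk _ b a) (sym (unfold-reverse a P)) (walk-++ (walk-reverse w) (colored-sym e) stay)

first∈ : Walk B a b P → a ∈ P
first∈ stay       = here refl
first∈ (step _ _) = here refl

last∈ : Walk B a b P → b ∈ P
last∈ stay       = here refl
last∈ (step _ w) = there (last∈ w)

lookup-first : Walk B a b P → ∀ i → toℕ i ≡ 0 → lookup P i ≡ a
lookup-first stay       zero _ = refl
lookup-first (step _ _) zero _ = refl

walk-adjacent : Walk B a b P → ∀ i j → toℕ j ≡ suc (toℕ i) → Colored B (lookup P i) (lookup P j)
walk-adjacent stay       zero    zero    ()
walk-adjacent (step e w) zero    (suc j) eq =
  subst (Colored _ _) (sym (lookup-first w j (suc-injective eq))) e
walk-adjacent (step e w) (suc i) (suc j) eq = walk-adjacent w i j (suc-injective eq)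

walk⇒copy : Walk B a b P → Unique P → HasCopy (Path (length P)) B
walk⇒copy {P = P} w P! = lookup P , (λ {i} {j} → unique-lookup-injective P! i j) , λ where
  i j (inj₁ eq) → walk-adjacent w i j eq
  i j (inj₂ eq) → colored-sym (walk-adjacent w j i eq)

-- Families of separate blue paths

record Strand (N : ℕ) : Set where
  constructor strand
  field
    start end : Fin N
    verts     : List (Fin N)
open Strand

single : Fin N → Strand N
single x = strand x x [ x ]

Good : List (Edge N) → Strand N → Set
Good B K = Walk B (start K) (end K) (verts K) × Unique (verts K)

-- Blue edges are excluded as well, so that an edge joining two strands is legal as soon as it is
-- not red.
record Apart (B : List (Edge N)) (K K′ : Strand N) : Set where
  constructor apart-by
  field
    separate : ∀ {x y} → x ∈ verts K → y ∈ verts K′ → x ≢ y × ¬ Colored B x y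
open Apart

record Forest (B : List (Edge N)) (Ks : List (Strand N)) : Set where
  constructor forest
  field
    good  : All (Good B) Ks
    apart : AllPairs (Apart B) Ks

apart-sym : {K K′ : Strand N} → Apart B K K′ → Apart B K′ K
apart-sym K#K′ = apart-by λ x∈ y∈ →
  let x≢y , free = separate K#K′ y∈ x∈ in x≢y ∘ sym , free ∘ colored-sym

permute : ∀ {Ks Ks′} → Ks ↭ Ks′ → Forest B Ks → Forest B Ks′
permute {B = B} σ (forest good apart) = forest (All-resp-↭ σ good)
  (Setoid.AllPairs-resp-↭ (setoid _) {R = Apart B} apart-sym
    ((λ { refl p → p }) , (λ { refl p → p })) (↭⇒↭ₛ σ) apart)

exchange : ∀ {K K′ Ks} → Forest B (K ∷ K′ ∷ Ks) → Forest B (K′ ∷ K ∷ Ks)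
exchange = permute (↭-swap _ _ ↭-refl)

unique-reverse : Unique P → Unique (reverse P)
unique-reverse {P = P} = Setoid.Unique-resp-↭ (setoid _) (↭⇒↭ₛ (↭-sym (↭-reverse P)))

flip : ∀ {Ks} → Forest B (strand a b P ∷ Ks) → Forest B (strand b a (reverse P) ∷ Ks)
flip (forest ((w , P!) ∷ good) (K# ∷ apart)) =
  forest ((walk-reverse w , unique-reverse P!) ∷ good)
    (All.map (λ K#K′ → apart-by λ x∈ → separate K#K′ (reverse⁻ x∈)) K# ∷ apart)

flip₂ : ∀ {K Ks} → Forest B (K ∷ strand a b P ∷ Ks) → Forest B (K ∷ strand b a (reverse P) ∷ Ks)
flip₂ = exchange ∘ flip ∘ exchange

link-uncolored : ∀ {Ks} → Forest B (strand a b P ∷ strand c d Q ∷ Ks) → ¬ Colored R b c → Uncolored B R b c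
link-uncolored (forest ((w , _) ∷ (w′ , _) ∷ _) ((K#K′ ∷ _) ∷ _)) ¬red =
  let b≢c , ¬blue = separate K#K′ (last∈ w) (first∈ w′) in b≢c , ¬blue , ¬red

-- Both ends of the new edge lie in the merged strand, so it cannot run between two strands of the
-- new list. `merge` checks this for pairs with the merged strand, `keep` for two untouched strands.
link : ∀ {Ks} → Forest B (strand a b P ∷ strand c d Q ∷ Ks) →
       Forest ((b , c) ∷ B) (strand a d (P ++ Q) ∷ Ks)
link {B = B} {a = a} {b = b} {P = P} {c = c} {d = d} {Q = Q}
     (forest ((w , P!) ∷ (w′ , Q!) ∷ good) ((K#K′ ∷ K#) ∷ K′# ∷ apart)) =
  forest ((walk-++ (walk-∷ w) (inj₁ (here refl)) (walk-∷ w′) ,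
           Unique.++⁺ P! Q! (λ (x∈ , x∈′) → proj₁ (separate K#K′ x∈ x∈′) refl))
          ∷ All.map (λ (w , !) → walk-∷ w , !) good)
         (All.zipWith merge (K# , K′#) ∷ others (All.zip (K# , K′#)) apart)
  where
  OffLink : Strand _ → Set
  OffLink K = Apart B (strand a b P) K × Apart B (strand c d Q) K
  merge : ∀ {K} → OffLink K → Apart ((b , c) ∷ B) (strand a d (P ++ Q)) K
  merge {K} (P# , Q#) = apart-by λ x∈ y∈ →
    proj₁ (old x∈) y∈ , λ col → either (new y∈) (proj₂ (old x∈) y∈) (colored-∷⁻ col)
    where
    old : ∀ {x y} → x ∈ P ++ Q → (y ∈ verts K → x ≢ y) × (y ∈ verts K → ¬ Colored B x y)
    old x∈ = either (λ x∈P → proj₁ ∘ separate P# x∈P , proj₂ ∘ separate P# x∈P)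
                    (λ x∈Q → proj₁ ∘ separate Q# x∈Q , proj₂ ∘ separate Q# x∈Q) (∈-++⁻ P x∈)
    new : ∀ {x y} → y ∈ verts K → ¬ (x , y) ≈ (b , c)
    new y∈ (inj₁ (_ , y≡c)) = proj₁ (separate Q# (first∈ w′) y∈) (sym y≡c)
    new y∈ (inj₂ (_ , y≡b)) = proj₁ (separate P# (last∈ w) y∈) (sym y≡b)
  keep : ∀ {K K′} → OffLink K → Apart B K K′ → Apart ((b , c) ∷ B) K K′
  keep {K} (P# , Q#) K#K′ = apart-by λ x∈ y∈ →
    let x≢y , ¬blue = separate K#K′ x∈ y∈ in x≢y , λ col → either (new x∈) ¬blue (colored-∷⁻ col)
    where
    new : ∀ {x y} → x ∈ verts K → ¬ (x , y) ≈ (b , c)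
    new x∈ (inj₁ (x≡b , _)) = proj₁ (separate P# (last∈ w) x∈) (sym x≡b)
    new x∈ (inj₂ (x≡c , _)) = proj₁ (separate Q# (first∈ w′) x∈) (sym x≡c)
  others : ∀ {Ks} → All OffLink Ks → AllPairs (Apart B) Ks → AllPairs (Apart ((b , c) ∷ B)) Ks
  others []           []           = []
  others (off ∷ offs) (K# ∷ apart) = All.map (keep off) K# ∷ others offs apart

-- Joining two strands as a move

play-link : ∀ {Ks} → Forest B (strand a b P ∷ strand c d Q ∷ Ks) → ¬ Colored R b c → 3 + length R ≤ n →
            (∀ x y → Forest ((b , c) ∷ B) (strand a d (P ++ Q) ∷ Ks) →
              AliceWins (Path n) ((b , c) ∷ B) ((x , y) ∷ R)) →
            AliceWins (Path n) B R
play-link F free short next = play _ _ (link-uncolored F free) short λ x y → next x y (link F)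

win-link : ∀ {Ks} → Forest B (strand a b P ∷ strand c d Q ∷ Ks) → ¬ Colored R b c →
           length P + length Q ≡ n → AliceWins (Path n) B R
win-link {P = P} F free refl with link F
... | forest ((w , PQ!) ∷ _) _ =
  move _ _ (link-uncolored F free)
    (inj₁ (subst (λ n → HasCopy (Path n) _) (length-++ P) (walk⇒copy w PQ!)))
win-end : ∀ {Ks} → Forest B (strand a b P ∷ strand c d Q ∷ Ks) →
          t ∈ c ∷ d ∷ [] → ¬ Colored R b t → length P + length Q ≡ n → AliceWins (Path n) B R
win-end F (here refl) free eq = win-link F free eq
win-end {P = P} {Q = Q} F (there (here refl)) free eq =
  win-link (flip₂ F) free (trans (cong (length P +_) (length-reverse Q)) eq)

-- `win-link` joins the end of the first strand to the start of the second; reversing strands brings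
-- any other choice of ends into that form.
win-ends : ∀ {Ks} → Forest B (strand a b P ∷ strand c d Q ∷ Ks) →
           s ∈ a ∷ b ∷ [] → t ∈ c ∷ d ∷ [] → ¬ Colored R s t →
           length P + length Q ≡ n → AliceWins (Path n) B R
win-ends {P = P} {Q = Q} F (here refl) t∈ free eq =
  win-end (flip F) t∈ free (trans (cong (_+ length Q) (length-reverse P)) eq)
win-ends F (there (here refl)) t∈ free eq = win-end F t∈ free eq

-- Four edges join the ends of the two strands, more than E can block.
win-square : ∀ {Ks} E → Forest B (strand a b P ∷ strand c d Q ∷ Ks) → a ≢ b → c ≢ d → length E ≤ 3 →
             (∀ {s t} → s ∈ a ∷ b ∷ [] → t ∈ c ∷ d ∷ [] → Colored R s t → Colored E s t) →
             length P + length Q ≡ n → AliceWins (Path n) B R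
win-square {a = a} {b} {c = c} {d} E F@(forest ((w , _) ∷ (w′ , _) ∷ _) ((K# ∷ _) ∷ _)) a≢b c≢d E≤3 cover eq =
  let s , t , s∈ , t∈ , free = uncolored-crossing {S = a ∷ b ∷ []} {T = c ∷ d ∷ []} E
        ((a≢b ∷ []) ∷ [] ∷ []) ((c≢d ∷ []) ∷ [] ∷ [])
        (λ (x∈ , x∈′) → proj₁ (separate K# (ends w x∈) (ends w′ x∈′)) refl) (s≤s E≤3)
  in win-ends F s∈ t∈ (free ∘ cover s∈ t∈) eq
  where
  ends : ∀ {x u v W} → Walk _ u v W → x ∈ u ∷ v ∷ [] → x ∈ W
  ends w (here refl)         = first∈ w
  ends w (there (here refl)) = last∈ w

-- The red edges that still matter

_≈?_ : (e f : Edge N) → Dec (e ≈ f)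
(a , b) ≈? (c , d) = (a ≟ c ×-dec b ≟ d) ⊎-dec (a ≟ d ×-dec b ≟ c)

≉-left : s ≢ c → s ≢ d → ¬ (s , t) ≈ (c , d)
≉-left s≢c s≢d (inj₁ (s≡c , _)) = s≢c s≡c
≉-left s≢c s≢d (inj₂ (s≡d , _)) = s≢d s≡d

≉-right : t ≢ c → t ≢ d → ¬ (s , t) ≈ (c , d)
≉-right t≢c t≢d (inj₁ (_ , t≡d)) = t≢d t≡d
≉-right t≢c t≢d (inj₂ (_ , t≡c)) = t≢c t≡c

≉-avoid : s ≢ c → t ≢ c → ¬ (s , t) ≈ (c , d)
≉-avoid s≢c t≢c (inj₁ (s≡c , _)) = s≢c s≡c
≉-avoid s≢c t≢c (inj₂ (_ , t≡c)) = t≢c t≡c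

-- The red edges that matter when one strand has ends b and a and the remaining
-- vertices U are single: apart from e they all equal av.
Cover : (R : List (Edge N)) (b a : Fin N) (U : List (Fin N)) (v : Fin N) (e : Edge N) → Set
Cover R b a U v e =
  ∀ {s t} → s ∈ b ∷ a ∷ U → t ∈ U → s ≢ t → Colored R s t → (s , t) ≈ (a , v) ⊎ (s , t) ≈ e

path-off-singles : Forest B (strand b a P ∷ map single U) → s ∈ P → t ∈ U → s ≢ t
path-off-singles (forest _ (K# ∷ _)) s∈ t∈ = proj₁ (separate (All.lookup (All.map⁻ K#) t∈) s∈ (here refl))

singles-unique : ∀ {K} → Forest B (K ∷ map single U) → Unique U
singles-unique (forest _ (_ ∷ apart)) =
  AllPairs.map (λ x#y → proj₁ (separate x#y (here refl) (here refl))) (AllPairs.map⁻ apart)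

ends-on-path : ∀ {Ks} → Forest B (strand a b P ∷ Ks) → s ∈ a ∷ b ∷ [] → s ∈ P
ends-on-path (forest ((w , _) ∷ _) _) (here refl)         = first∈ w
ends-on-path (forest ((w , _) ∷ _) _) (there (here refl)) = last∈ w

-- Endgame with three single vertices left

module LastThree {B R : List (Edge N)} {b a x y z v : Fin N} {P : List (Fin N)} {e : Edge N}
  (F : Forest B (strand b a P ∷ map single (x ∷ y ∷ z ∷ []))) (b≢a : b ≢ a)
  (cover : Cover R b a (x ∷ y ∷ z ∷ []) v e)
  (size : length P + 3 ≡ n) (rounds : length R + 4 ≡ n) where

  x∈ : x ∈ x ∷ y ∷ z ∷ []
  x∈ = here refl
  y∈ : y ∈ x ∷ y ∷ z ∷ []
  y∈ = there (here refl)
  z∈ : z ∈ x ∷ y ∷ z ∷ []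
  z∈ = there (there (here refl))

  off : ∀ {s t} → s ∈ b ∷ a ∷ [] → t ∈ x ∷ y ∷ z ∷ [] → s ≢ t
  off s∈ t∈ = path-off-singles F (ends-on-path F s∈) t∈

  b∈ : b ∈ b ∷ a ∷ []
  b∈ = here refl
  a∈ : a ∈ b ∷ a ∷ []
  a∈ = there (here refl)

  x≢y : x ≢ y
  x≢y with singles-unique F
  ... | (x≢y ∷ _) ∷ _ = x≢y
  x≢z : x ≢ z
  x≢z with singles-unique F
  ... | (_ ∷ x≢z ∷ _) ∷ _ = x≢z
  y≢z : y ≢ z
  y≢z with singles-unique F
  ... | _ ∷ (y≢z ∷ _) ∷ _ = y≢z

  size′ : 3 + length P ≡ n
  size′ = trans (+-comm 3 (length P)) size

  round₁ : 3 + length R ≤ n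
  round₁ = ≤-trans (m≤n+m _ 1) (≤-reflexive (trans (+-comm 4 (length R)) rounds))

  -- One more than in `round₁`: at Alice's second move Bob's first reply is already red. Her third
  -- move wins at once.
  round₂ : 4 + length R ≤ n
  round₂ = ≤-reflexive (trans (+-comm 4 (length R)) rounds)

  end∈ : ∀ {s} → s ∈ b ∷ a ∷ [] → s ∈ b ∷ a ∷ x ∷ y ∷ z ∷ []
  end∈ (here p)         = here p
  end∈ (there (here p)) = there (here p)

  single∈ : ∀ {s} → s ∈ x ∷ y ∷ z ∷ [] → s ∈ b ∷ a ∷ x ∷ y ∷ z ∷ []
  single∈ s∈ = there (there s∈)

  xy∈ : ∀ {t} → t ∈ x ∷ y ∷ [] → t ∈ x ∷ y ∷ z ∷ []
  xy∈ (here p)         = here p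
  xy∈ (there (here p)) = there (here p)

  xz∈ : ∀ {t} → t ∈ x ∷ z ∷ [] → t ∈ x ∷ y ∷ z ∷ []
  xz∈ (here p)         = here p
  xz∈ (there (here p)) = there (there (here p))

  free : ∀ {s t} → s ∈ x ∷ y ∷ z ∷ [] → t ∈ x ∷ y ∷ z ∷ [] → s ≢ t → ¬ (s , t) ≈ e → ¬ Colored R s t
  free s∈ t∈ s≢t ≉e red =
    either (≉-avoid (≢-sym (off a∈ s∈)) (≢-sym (off a∈ t∈))) ≉e (cover (single∈ s∈) t∈ s≢t red)

  xy-first : Forest B (single x ∷ single y ∷ strand b a P ∷ single z ∷ [])
  xy-first = permute (↭-trans (↭-swap _ _ ↭-refl) (↭-prep _ (↭-swap _ _ ↭-refl))) F

  -- Here `e` can only be `xz`. Alice plays `xy`, and her next move makes one old red edge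
  -- irrelevant: after `az` the vertex `a` is inside the path, which removes `av`; after `yz` both
  -- ends of `xz` lie on one strand. Bob's two replies and one old edge then face four joining
  -- edges.
  one-blocked : z ≢ v → (∀ {s t} → (s , t) ≈ e → (s , t) ≈ (x , z)) → AliceWins (Path n) B R
  one-blocked z≢v e≈xz = play-link xy-first (free x∈ y∈ x≢y (≉-right (≢-sym x≢y) y≢z ∘ e≈xz)) round₁ reply
    where
    reply : ∀ f₁ f₂ → Forest ((x , y) ∷ B) (strand x y (x ∷ y ∷ []) ∷ strand b a P ∷ single z ∷ []) →
            AliceWins (Path n) ((x , y) ∷ B) ((f₁ , f₂) ∷ R)
    reply f₁ f₂ F₁ with (y , z) ≈? (f₁ , f₂)
    -- `az` is free: it is not `av` because `z ≢ v`, and neither `xz` nor `yz` touches `a`.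
    ... | yes yz≈f = play-link (permute (↭-trans (↭-swap _ _ ↭-refl) (↭-prep _ (↭-swap _ _ ↭-refl))) F₁)
          (λ red → either (λ az≈f → ≉-left (off a∈ y∈) (off a∈ z∈) (≈-common az≈f yz≈f)) az-free (colored-∷⁻ red))
          round₂ λ g₁ g₂ F₂ → win-square ((g₁ , g₂) ∷ (f₁ , f₂) ∷ e ∷ []) F₂ (off b∈ z∈) x≢y ≤-refl
            (λ s∈ t∈ → colored-mono (colored-mono (colored-here ∘ bz–xy s∈ t∈)))
            (trans (cong (_+ 2) (length-++ P)) (trans (+-assoc (length P) 1 2) size))
      where
      az-free : ¬ Colored R a z
      az-free red with cover (end∈ a∈) z∈ (off a∈ z∈) red
      ... | inj₁ (inj₁ (_ , z≡v)) = z≢v z≡v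
      ... | inj₁ (inj₂ (_ , z≡a)) = off a∈ z∈ (sym z≡a)
      ... | inj₂ az≈e             = ≉-left (off a∈ x∈) (off a∈ z∈) (e≈xz az≈e)
      bz–xy : ∀ {s t} → s ∈ b ∷ z ∷ [] → t ∈ x ∷ y ∷ [] → Colored R s t → (s , t) ≈ e
      bz–xy {s} {t} s∈ t∈ red = either (λ ≈av → contradiction ≈av (≉-avoid (s≢a s∈) (≢-sym (off a∈ t∈′))))
                             (λ ≈e → ≈e) (cover (s∈′ s∈) t∈′ (s≢t s∈ t∈) red)
        where
        t∈′ : t ∈ x ∷ y ∷ z ∷ []
        t∈′ = xy∈ t∈
        s∈′ : ∀ {s} → s ∈ b ∷ z ∷ [] → s ∈ b ∷ a ∷ x ∷ y ∷ z ∷ []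
        s∈′ (here refl)         = end∈ b∈
        s∈′ (there (here refl)) = single∈ z∈
        s≢a : ∀ {s} → s ∈ b ∷ z ∷ [] → s ≢ a
        s≢a (here refl)         = b≢a
        s≢a (there (here refl)) = ≢-sym (off a∈ z∈)
        s≢t : ∀ {s t} → s ∈ b ∷ z ∷ [] → t ∈ x ∷ y ∷ [] → s ≢ t
        s≢t (here refl)         t∈                  = off b∈ (xy∈ t∈)
        s≢t (there (here refl)) (here refl)         = ≢-sym x≢z
        s≢t (there (here refl)) (there (here refl)) = ≢-sym y≢z
    ... | no yz≉f = play-link (permute (↭-prep _ (↭-swap _ _ ↭-refl)) F₁)
          (λ red → either yz≉f (free y∈ z∈ y≢z (≉-left (≢-sym x≢y) y≢z ∘ e≈xz)) (colored-∷⁻ red))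
          round₂ λ g₁ g₂ F₂ → win-square ((g₁ , g₂) ∷ (f₁ , f₂) ∷ (a , v) ∷ []) (exchange F₂) b≢a x≢z ≤-refl
            (λ s∈ t∈ → colored-mono (colored-mono (colored-here ∘ ba–xz s∈ t∈))) size
      where
      ba–xz : ∀ {s t} → s ∈ b ∷ a ∷ [] → t ∈ x ∷ z ∷ [] → Colored R s t → (s , t) ≈ (a , v)
      ba–xz s∈ t∈ red = either (λ ≈av → ≈av)
        (λ ≈e → contradiction (e≈xz ≈e) (≉-left (off s∈ x∈) (off s∈ z∈)))
        (cover (end∈ s∈) (xz∈ t∈) (off s∈ (xz∈ t∈)) red)

  -- No edge among the three vertices is red, and only `x` can equal `v`. Alice plays `xy`. If Bob
  -- takes `xz`, she plays `yz` and his edge becomes a chord of her strand. Otherwise `xz` gives a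
  -- strand with ends `y` and `z`, both different from `v`, so `av` drops out.
  none-blocked : y ≢ v → z ≢ v →
    (∀ {s t} → s ∈ x ∷ y ∷ z ∷ [] → t ∈ x ∷ y ∷ z ∷ [] → s ≢ t → ¬ (s , t) ≈ e) → AliceWins (Path n) B R
  none-blocked y≢v z≢v e∉ = play-link xy-first (free x∈ y∈ x≢y (e∉ x∈ y∈ x≢y)) round₁ reply
    where
    reply : ∀ f₁ f₂ → Forest ((x , y) ∷ B) (strand x y (x ∷ y ∷ []) ∷ strand b a P ∷ single z ∷ []) →
            AliceWins (Path n) ((x , y) ∷ B) ((f₁ , f₂) ∷ R)
    reply f₁ f₂ F₁ with (x , z) ≈? (f₁ , f₂)
    ... | yes xz≈f = play-link (permute (↭-prep _ (↭-swap _ _ ↭-refl)) F₁)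
          (λ red → either (λ yz≈f → ≉-left (≢-sym x≢y) y≢z (≈-common yz≈f xz≈f)) (free y∈ z∈ y≢z (e∉ y∈ z∈ y≢z))
                          (colored-∷⁻ red))
          round₂ λ g₁ g₂ F₂ → win-square ((g₁ , g₂) ∷ (a , v) ∷ e ∷ []) (exchange F₂) b≢a x≢z ≤-refl
            (λ s∈ t∈ → colored-mono λ red → either
              (λ st≈f → contradiction (≈-common st≈f xz≈f) (≉-left (off s∈ x∈) (off s∈ z∈)))
              (λ red → either colored-here (colored-there ∘ colored-here)
                (cover (end∈ s∈) (xz∈ t∈) (off s∈ (xz∈ t∈)) red))
              (colored-∷⁻ red)) size
    ... | no xz≉f = play-link (flip (permute (↭-prep _ (↭-swap _ _ ↭-refl)) F₁))
          (λ red → either xz≉f (free x∈ z∈ x≢z (e∉ x∈ z∈ x≢z)) (colored-∷⁻ red))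
          round₂ λ g₁ g₂ F₂ → win-square ((g₁ , g₂) ∷ (f₁ , f₂) ∷ e ∷ []) (exchange F₂) b≢a y≢z ≤-refl
            (λ s∈ t∈ → colored-mono (colored-mono λ red → either
              (λ ≈av → contradiction ≈av (≉-right (≢-sym (off a∈ (there t∈))) (t≢v t∈))) colored-here
              (cover (end∈ s∈) (there t∈) (off s∈ (there t∈)) red))) size
      where
      t≢v : ∀ {t} → t ∈ y ∷ z ∷ [] → t ≢ v
      t≢v (here refl)         = y≢v
      t≢v (there (here refl)) = z≢v

-- Choosing the roles of the last three vertices

abstract
  extract : s ∈ U → ∃ λ U′ → U ↭ s ∷ U′
  extract s∈ with ∈-∃++ s∈
  ... | S , T , refl = S ++ T , shift _ S T

cover-resp-↭ : ∀ {e} → U ↭ T → Cover R b a U v e → Cover R b a T v e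
cover-resp-↭ σ cover s∈ t∈ = cover (∈-resp-↭ (↭-prep _ (↭-prep _ (↭-sym σ))) s∈) (∈-resp-↭ (↭-sym σ) t∈)

permute-singles : ∀ {K} → U ↭ T → Forest B (K ∷ map single U) → Forest B (K ∷ map single T)
permute-singles σ = permute (↭-prep _ (map⁺ single σ))

extract-length : ∀ {U′} → U ↭ s ∷ U′ → length U ≡ suc k → length U′ ≡ k
extract-length σ eq = suc-injective (trans (sym (↭-length σ)) eq)

-- The given vertices go to the outer places because `one-blocked` expects the blocked edge to join
-- the first and the third vertex.
extract-two : s ∈ U → t ∈ U → s ≢ t → length U ≡ 3 → ∃ λ r → U ↭ s ∷ r ∷ t ∷ []
extract-two s∈ t∈ s≢t three with extract s∈
... | U′ , σ with ∈-resp-↭ σ t∈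
...   | here t≡s = contradiction (sym t≡s) s≢t
...   | there t∈′ with extract t∈′
...     | U″ , τ with U″ | τ | extract-length τ (extract-length σ three)
...       | r ∷ [] | τ | refl = r , ↭-trans σ (↭-prep _ (↭-trans τ (↭-swap _ _ ↭-refl)))

triple : ∀ (U : List (Fin N)) → length U ≡ 3 → ∃ λ x → ∃₂ λ y z → U ≡ x ∷ y ∷ z ∷ []
triple (x ∷ y ∷ z ∷ []) refl = x , y , z , refl

module _ {N : ℕ} where
  open import Data.List.Membership.DecPropositional (_≟_ {N}) public using (_∈?_)

-- If `e` joins two of the last vertices, `one-blocked` applies with an endpoint of `e` other than
-- `v` in last place; two distinct endpoints cannot both be `v`. If not, `none-blocked` applies once
-- `v`, if present, comes first.
win-last-three : ∀ {e} → Forest B (strand b a P ∷ map single U) → b ≢ a → length U ≡ 3 →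
                 Cover R b a U v e → length P + 3 ≡ n → length R + 4 ≡ n → AliceWins (Path n) B R
win-last-three {B = B} {b = b} {a = a} {P = P} {U = U} {R = R} {v = v} {n = n} {e = e@(p , q)}
               F b≢a three cover size rounds
  -- The test `p ≢ q` is made because `play` lets Bob's reply be any pair, even a loop.
  with p ∈? U ×-dec q ∈? U ×-dec ¬? (p ≟ q)
... | yes (p∈ , q∈ , p≢q) = split (q ≟ v)
  where
  blocked : ∀ {s r t} → U ↭ s ∷ r ∷ t ∷ [] → t ≢ v → (∀ {x y} → (x , y) ≈ e → (x , y) ≈ (s , t)) →
            AliceWins (Path n) B R
  blocked σ = LastThree.one-blocked (permute-singles σ F) b≢a (cover-resp-↭ σ cover) size rounds
  split : Dec (q ≡ v) → AliceWins (Path n) B R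
  split (no q≢v)   = blocked (proj₂ (extract-two p∈ q∈ p≢q three)) q≢v (λ eq → eq)
  split (yes refl) = blocked (proj₂ (extract-two q∈ p∈ (≢-sym p≢q) three)) p≢q swap
... | no ¬pq = split (v ∈? U)
  where
  outside : ∀ {s t} → s ∈ U → t ∈ U → s ≢ t → ¬ (s , t) ≈ e
  outside s∈ t∈ s≢t (inj₁ (refl , refl)) = ¬pq (s∈ , t∈ , s≢t)
  outside s∈ t∈ s≢t (inj₂ (refl , refl)) = ¬pq (t∈ , s∈ , ≢-sym s≢t)
  unblocked : ∀ {x y z} → U ↭ x ∷ y ∷ z ∷ [] → y ≢ v → z ≢ v → AliceWins (Path n) B R
  unblocked σ y≢v z≢v =
    LastThree.none-blocked (permute-singles σ F) b≢a (cover-resp-↭ σ cover) size rounds y≢v z≢v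
      λ s∈ t∈ → outside (∈-resp-↭ (↭-sym σ) s∈) (∈-resp-↭ (↭-sym σ) t∈)
  split : Dec (v ∈ U) → AliceWins (Path n) B R
  split (yes v∈) with extract v∈
  ... | U′ , σ with U′ | σ | extract-length σ three | singles-unique (permute-singles σ F)
  ...   | y ∷ z ∷ [] | σ | refl | (v≢y ∷ v≢z ∷ []) ∷ _ = unblocked σ (≢-sym v≢y) (≢-sym v≢z)
  split (no v∉) with x , y , z , U≡ ← triple U three =
    unblocked (↭-reflexive U≡) (λ { refl → v∉ (subst (_ ∈_) (sym U≡) (there (here refl))) })
                               (λ { refl → v∉ (subst (_ ∈_) (sym U≡) (there (there (here refl)))) })

-- Extending the path one vertex at a time

record Extension (b a : Fin N) (U : List (Fin N)) (v : Fin N) (e : Edge N) : Set where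
  field
    x w   : Fin N
    x∈    : x ∈ U
    free  : ¬ Colored ((a , v) ∷ e ∷ []) a x
    -- As far as it still matters, `e` touches an end of the longer path, either the new end `x` or
    -- the old end `b`, and `w` is its other endpoint. Pairs through `a` are left out, since `a`
    -- becomes an inner vertex.
    turn  : (∀ {s t} → s ∈ b ∷ U → t ∈ U → s ≢ t → s ≢ a → t ≢ a → (s , t) ≈ e → (s , t) ≈ (x , w)) ⊎
            (∀ {s t} → s ∈ b ∷ U → t ∈ U → s ≢ t → s ≢ a → t ≢ a → (s , t) ≈ e → (s , t) ≈ (b , w))

-- Extending from a makes the red edges at a irrelevant. It remains to bring e to an
-- end of the path: go to an end of e if possible; otherwise e can only be bv.
extension : ∀ e → Unique U → a ∉ U → 3 ≤ length U → Extension b a U v e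
extension {U = U} {a = a} {b = b} {v = v} e@(p , q) U! a∉ 3≤ = split (reach? p) (reach? q)
  where
  Es = (a , v) ∷ e ∷ []
  Reach : Fin _ → Set
  Reach x = x ∈ U × ¬ Colored Es a x
  reach? : ∀ x → Dec (Reach x)
  reach? x = x ∈? U ×-dec ¬? (colored? Es a x)
  -- Only `av` can keep an endpoint of `e` in `U` from being reached: `e` avoids `a` here, so it is
  -- not the edge from `a` to that endpoint.
  blocked : ∀ {s t} → t ∈ U → s ≢ a → t ≢ a → (s , t) ≈ e → ¬ Reach t → t ≡ v
  blocked {s} {t} t∈ s≢a t≢a ≈e ¬reach
    with colored-∷⁻ (decidable-stable (colored? Es a t) λ free → ¬reach (t∈ , free))
  ... | inj₁ (inj₁ (_ , t≡v)) = t≡v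
  ... | inj₁ (inj₂ (_ , t≡a)) = contradiction t≡a t≢a
  ... | inj₂ col with colored-∷⁻ col
  ...   | inj₁ at≈e = contradiction (≈-common at≈e ≈e) (≉-left (≢-sym s≢a) (≢-sym t≢a))
  ...   | inj₂ (inj₁ ())
  ...   | inj₂ (inj₂ ())
  split : Dec (Reach p) → Dec (Reach q) → Extension b a U v e
  split (yes (p∈ , free)) _ = record { x = p ; w = q ; x∈ = p∈ ; free = free ; turn = inj₁ λ _ _ _ _ _ eq → eq }
  split (no _) (yes (q∈ , free)) =
    record { x = q ; w = p ; x∈ = q∈ ; free = free ; turn = inj₁ λ _ _ _ _ _ → swap }
  split (no ¬p) (no ¬q)
    -- Two edges cannot block `a` from at least three vertices.
    with uncolored-crossing {S = [ a ]} Es ([] ∷ []) U! (λ { (here refl , a∈) → a∉ a∈ })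
           (≤-trans 3≤ (≤-reflexive (sym (+-identityʳ (length U)))))
  ... | _ , x , here refl , x∈ , free = record { x = x ; w = v ; x∈ = x∈ ; free = free ; turn = inj₂ turn }
    where
    unreachable : ∀ {s t} → (s , t) ≈ e → ¬ Reach s × ¬ Reach t
    unreachable (inj₁ (refl , refl)) = ¬p , ¬q
    unreachable (inj₂ (refl , refl)) = ¬q , ¬p
    turn : ∀ {s t} → s ∈ b ∷ U → t ∈ U → s ≢ t → s ≢ a → t ≢ a → (s , t) ≈ e → (s , t) ≈ (b , v)
    turn s∈ t∈ s≢t s≢a t≢a ≈e
      with blocked t∈ s≢a t≢a ≈e (proj₂ (unreachable ≈e)) | s∈
    ... | t≡v | here s≡b  = inj₁ (s≡b , t≡v)
    ... | t≡v | there s∈U =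
      contradiction (trans (blocked s∈U t≢a s≢a (≈-flip ≈e) (proj₁ (unreachable ≈e))) (sym t≡v)) s≢t

-- Each round moves one vertex from `U` to the path and adds one red edge, so both sums stay equal
-- to `n`. The older of the two relevant red edges is kept at `a`, the end from which the next move
-- extends.
win-path : ∀ m v {e} → Forest B (strand b a P ∷ map single U) → b ≢ a → length U ≡ 3 + m →
           Cover R b a U v e → length P + length U ≡ n → length R + suc (length U) ≡ n →
           AliceWins (Path n) B R
win-path {P = P} {R = R} zero v F b≢a len cover size rounds = win-last-three F b≢a len cover
  (trans (cong (length P +_) (sym len)) size) (trans (cong (λ l → length R + suc l) (sym len)) rounds)
win-path {B = B} {b = b} {a = a} {P = P} {U = U} {R = R} {n = n} (suc m) v {e} F b≢a len cover size rounds =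
  play-link {d = x} {Q = [ x ]} F′ ax-free short reply
  where
  off : ∀ {s t} → s ∈ b ∷ a ∷ [] → t ∈ U → s ≢ t
  off s∈ t∈ = path-off-singles F (ends-on-path F s∈) t∈
  a≢ : ∀ {t} → t ∈ U → t ≢ a
  a≢ t∈ = ≢-sym (off (there (here refl)) t∈)
  open Extension (extension {b = b} {v = v} e (singles-unique F) (λ a∈ → a≢ a∈ refl)
                   (≤-trans (m≤m+n 3 (suc m)) (≤-reflexive (sym len))))
  U′ = proj₁ (extract x∈)
  σ : U ↭ x ∷ U′
  σ = proj₂ (extract x∈)
  F′ : Forest B (strand b a P ∷ single x ∷ map single U′)
  F′ = permute-singles σ F
  len′ : length U′ ≡ 3 + m
  len′ = extract-length σ len
  b≢x : b ≢ x
  b≢x = off (here refl) x∈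
  ax-free : ¬ Colored R a x
  ax-free red with cover (there (here refl)) x∈ (off (there (here refl)) x∈) red
  ... | inj₁ ≈av = free (colored-here ≈av)
  ... | inj₂ ≈e  = free (colored-there (colored-here ≈e))
  rounds′ : length R + (2 + length U′) ≡ n
  rounds′ = trans (cong (λ l → length R + suc l) (sym (↭-length σ))) rounds
  short : 3 + length R ≤ n
  short = ≤-trans (≤-reflexive (+-comm 3 (length R)))
    (≤-trans (+-monoʳ-≤ (length R) (≤-trans (m≤m+n 3 (2 + m)) (≤-reflexive (cong (2 +_) (sym len′)))))
      (≤-reflexive rounds′))
  size′ : length (P ++ [ x ]) + length U′ ≡ n
  size′ = trans (cong (_+ length U′) (length-++ P))
    (trans (+-assoc (length P) 1 (length U′)) (trans (cong (length P +_) (sym (↭-length σ))) size))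
  rest∈ : ∀ {t} → t ∈ U′ → t ∈ U
  rest∈ t∈ = ∈-resp-↭ (↭-sym σ) (there t∈)
  rounds″ : suc (length R) + suc (length U′) ≡ n
  rounds″ = trans (sym (+-suc (length R) (suc (length U′)))) rounds′
  end∈ : ∀ {s} → s ∈ b ∷ x ∷ U′ → s ∈ b ∷ U
  end∈ (here s≡b)           = here s≡b
  end∈ (there (here refl))  = there x∈
  end∈ (there (there s∈U′)) = there (rest∈ s∈U′)
  old∈ : ∀ {s} → s ∈ b ∷ U → s ∈ b ∷ a ∷ U
  old∈ (here s≡b)  = here s≡b
  old∈ (there s∈U) = there (there s∈U)
  ≢a : ∀ {s} → s ∈ b ∷ U → s ≢ a
  ≢a (here refl) = b≢a
  ≢a (there s∈U) = a≢ s∈U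
  -- The slots rotate: `av` drops out because `a` is now inner, the old `e` becomes the edge at an
  -- end, and Bob's reply `f` takes the place of `e`.
  carry : ∀ {b′ a′ w f} → (∀ {s} → s ∈ b′ ∷ a′ ∷ U′ → s ∈ b ∷ x ∷ U′) →
          (∀ {s t} → s ∈ b ∷ U → t ∈ U → s ≢ t → s ≢ a → t ≢ a → (s , t) ≈ e → (s , t) ≈ (a′ , w)) →
          Cover (f ∷ R) b′ a′ U′ w f
  carry ⊆ at s∈ t∈ s≢t red with colored-∷⁻ red
  ... | inj₁ ≈f = inj₂ ≈f
  ... | inj₂ red′ with cover (old∈ (end∈ (⊆ s∈))) (rest∈ t∈) s≢t red′
  ...   | inj₁ ≈av = contradiction ≈av (≉-avoid (≢a (end∈ (⊆ s∈))) (a≢ (rest∈ t∈)))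
  ...   | inj₂ ≈e  = inj₁ (at (end∈ (⊆ s∈)) (rest∈ t∈) s≢t (≢a (end∈ (⊆ s∈))) (a≢ (rest∈ t∈)) ≈e)
  reply : ∀ f₁ f₂ → Forest ((a , x) ∷ B) (strand b x (P ++ [ x ]) ∷ map single U′) →
          AliceWins (Path n) ((a , x) ∷ B) ((f₁ , f₂) ∷ R)
  reply f₁ f₂ F₁ with turn
  ... | inj₁ at-x = win-path m _ F₁ b≢x len′ (carry id at-x) size′ rounds″
  -- When `e` sits at `b`, the path is reversed so that the next extension starts there.
  ... | inj₂ at-b = win-path m _ (flip F₁) (≢-sym b≢x) len′
    (carry (∈-resp-↭ (↭-swap _ _ ↭-refl)) at-b)
    (trans (cong (_+ length U′) (length-reverse (P ++ [ x ]))) size′) rounds″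

-- Opening moves, and the small boards `K₃` and `K₅`

¬colored-[] : ¬ Colored {N} [] u v
¬colored-[] (inj₁ ())
¬colored-[] (inj₂ ())

colored-single : ∀ {e} → Colored [ e ] u v → (u , v) ≈ e
colored-single col with colored-∷⁻ col
... | inj₁ ≈e       = ≈e
... | inj₂ (inj₁ ())
... | inj₂ (inj₂ ())

singletons : ∀ N → Forest [] (map single (allFin N))
singletons N = forest (All.map⁺ (All.universal (λ x → stay , [] ∷ []) _))
  (AllPairs.map⁺ (AllPairs.map (λ x≢y → apart-by λ { (here refl) (here refl) → x≢y , ¬colored-[] })
                               (Unique.allFin⁺ N)))

wins-≥5 : ∀ k → AliceWinsOn (Path (5 + k)) (5 + k)
wins-≥5 k = play-link (singletons (5 + k)) ¬colored-[] (m≤m+n 3 (2 + k)) λ f₁ f₂ F →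
  -- The only red edge fills the slot `e`; `zero` is a default value for `v`.
  win-path k zero F (λ ()) len (λ _ _ _ red → inj₂ (colored-single red))
    (cong (2 +_) len) (cong (2 +_) len)
  where
  len : length (tabulate {n = 3 + k} (λ i → Fin.suc (Fin.suc i))) ≡ 3 + k
  len = length-tabulate {n = 3 + k} (λ i → Fin.suc (Fin.suc i))

-- Two edges join the first blue edge to the third vertex, and Bob's single reply cannot block both.
wins-P₃-on-K₃ : AliceWinsOn (Path 3) 3
wins-P₃-on-K₃ = play-link (singletons 3) ¬colored-[] ≤-refl λ f₁ f₂ F →
  let s , t , s∈ , t∈ , free = uncolored-crossing {S = zero ∷ suc zero ∷ []} {T = [ suc (suc zero) ]}
        [ f₁ , f₂ ] (((λ ()) ∷ []) ∷ [] ∷ []) ([] ∷ [])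
        (λ { (here refl , here ()) ; (here refl , there ()) ; (there (here refl) , here ()) }) ≤-refl
  in win-ends F s∈ (there t∈) free refl

-- After two moves the blue path has three vertices and two vertices lie outside it, so four edges
-- would complete `P₄` against two red ones. On `K₄` only two such edges would remain.
wins-P₄-on-K₅ : AliceWinsOn (Path 4) 5
wins-P₄-on-K₅ = play-link (singletons 5) ¬colored-[] (s≤s (s≤s (s≤s z≤n))) second
  where
  third : ∀ {B R : List (Edge 5)} {a b c x y} →
          Forest B (strand a c (a ∷ b ∷ c ∷ []) ∷ map single (x ∷ y ∷ [])) → a ≢ c → length R ≡ 2 →
          AliceWins (Path 4) B R
  third {R = R} {a} {c = c} {x} {y} F a≢c len
    with uncolored-crossing {S = a ∷ c ∷ []} {T = x ∷ y ∷ []} R ((a≢c ∷ []) ∷ [] ∷ []) (singles-unique F)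
           (λ (s∈ , t∈) → path-off-singles F (ends-on-path F s∈) t∈ refl) (s≤s (≤-trans (≤-reflexive len) (m≤m+n 2 1)))
  ... | s , t , s∈ , here refl , free         = win-ends F s∈ (here refl) free refl
  ... | s , t , s∈ , there (here refl) , free =
    win-ends (permute (↭-prep _ (↭-swap _ _ ↭-refl)) F) s∈ (here refl) free refl
  second : ∀ {B : List (Edge 5)} f₁ f₂ →
           Forest B (strand zero (suc zero) (zero ∷ suc zero ∷ []) ∷ map single (tabulate {n = 3} (λ i → suc (suc i)))) →
           AliceWins (Path 4) B [ f₁ , f₂ ]
  second f₁ f₂ F
    -- Two targets suffice against one red edge; the fifth vertex stays in reserve for the third
    -- move.
    with uncolored-crossing {S = [ suc zero ]} {T = suc (suc zero) ∷ suc (suc (suc zero)) ∷ []}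
           [ f₁ , f₂ ] ([] ∷ []) (((λ ()) ∷ []) ∷ [] ∷ [])
           (λ { (here refl , here ()) ; (here refl , there (here ())) }) ≤-refl
  ... | _ , _ , here refl , here refl , free =
    play-link F free ≤-refl λ g₁ g₂ F₂ → third F₂ (λ ()) refl
  ... | _ , _ , here refl , there (here refl) , free =
    play-link (permute (↭-prep _ (↭-swap _ _ ↭-refl)) F) free ≤-refl λ g₁ g₂ F₂ → third F₂ (λ ()) refl

-- Bob's draw on `K₄`

fresh : (S : List (Fin N)) → length S < N → ∃ λ x → x ∉ S
fresh {N} S S<N = ¬∀⟶∃¬ N (_∈ S) (_∈? S) λ all∈ → <⇒≱ S<N
  (injective⇒≤ {f = Any.index ∘ all∈} λ {i} {j} eq →
    trans (lookup-index (all∈ i)) (trans (cong (lookup S) eq) (sym (lookup-index (all∈ j)))))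

unique-exhausts : ∀ {S : List (Fin N)} → Unique S → N ≤ length S → ∀ x → x ∈ S
unique-exhausts {S = S} S! N≤S x = decidable-stable (x ∈? S) λ x∉ →
  <⇒≱ (injective⇒≤ {f = lookup (x ∷ S)} λ {i} {j} →
    unique-lookup-injective (All.¬Any⇒All¬ S x∉ ∷ S!) i j) N≤S

-- Four distinct vertices exhaust `K₄`, so `uv` and `xy` form a perfect matching.
Opposite : (u v x y : Fin 4) → Set
Opposite u v x y = Unique (u ∷ v ∷ x ∷ y ∷ [])

opposite-sym : ∀ {u v x y} → Opposite u v x y → Opposite x y u v
opposite-sym ((u≢v ∷ u≢x ∷ u≢y ∷ []) ∷ (v≢x ∷ v≢y ∷ []) ∷ (x≢y ∷ []) ∷ [] ∷ []) =
  (x≢y ∷ ≢-sym u≢x ∷ ≢-sym v≢x ∷ []) ∷ (≢-sym u≢y ∷ ≢-sym v≢y ∷ []) ∷ (u≢v ∷ []) ∷ [] ∷ []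

opposite-≢ : ∀ {u v x y} → Opposite u v x y → u ≢ v
opposite-≢ ((u≢v ∷ _) ∷ _) = u≢v

opposite-disjoint : ∀ {u v x y} → Opposite u v x y → ¬ (u , v) ≈ (x , y)
opposite-disjoint ((_ ∷ u≢x ∷ u≢y ∷ []) ∷ _) = ≉-left u≢x u≢y

abstract
  opposite-exists : ∀ {u v} → u ≢ v → ∃₂ λ x y → Opposite x y u v
  opposite-exists {u} {v} u≢v with fresh (u ∷ v ∷ []) (m≤m+n 3 1)
  ... | x , x∉ with fresh (x ∷ u ∷ v ∷ []) ≤-refl
  ...   | y , y∉ = y , x , All.¬Any⇒All¬ _ y∉ ∷ All.¬Any⇒All¬ _ x∉ ∷ (u≢v ∷ []) ∷ [] ∷ []

opposite-rest : ∀ {u v x y s t z} → Opposite u v x y → (s , t) ≈ (u , v) → z ≢ s → z ≢ t → z ∈ x ∷ y ∷ []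
opposite-rest {z = z} opp st≈uv z≢s z≢t with unique-exhausts opp ≤-refl z | st≈uv
... | here refl         | inj₁ (refl , refl) = contradiction refl z≢s
... | here refl         | inj₂ (refl , refl) = contradiction refl z≢t
... | there (here refl) | inj₁ (refl , refl) = contradiction refl z≢t
... | there (here refl) | inj₂ (refl , refl) = contradiction refl z≢s
... | there (there z∈)  | _                  = z∈

-- By exhaustion `s′` and `t′` both lie on `xy`, and being distinct they are its two ends. The
-- pairing invariant can thus be checked for every labelling of the new edges.
opposite-unique : ∀ {u v x y s t s′ t′} → Opposite u v x y → Opposite s t s′ t′ →
                  (s , t) ≈ (u , v) → (s′ , t′) ≈ (x , y)
opposite-unique opp ((_ ∷ s≢s′ ∷ s≢t′ ∷ []) ∷ (t≢s′ ∷ t≢t′ ∷ []) ∷ (s′≢t′ ∷ []) ∷ [] ∷ []) st≈uv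
  with opposite-rest opp st≈uv (≢-sym s≢s′) (≢-sym t≢s′)
     | opposite-rest opp st≈uv (≢-sym s≢t′) (≢-sym t≢t′)
... | here s′≡x         | here t′≡x         = contradiction (trans s′≡x (sym t′≡x)) s′≢t′
... | here s′≡x         | there (here t′≡y) = inj₁ (s′≡x , t′≡y)
... | there (here s′≡y) | here t′≡x         = inj₂ (s′≡y , t′≡x)
... | there (here s′≡y) | there (here t′≡y) = contradiction (trans s′≡y (sym t′≡y)) s′≢t′

colored-resp-≈ : (s , t) ≈ (u , v) → Colored L s t → Colored L u v
colored-resp-≈ (inj₁ (refl , refl)) col = col
colored-resp-≈ (inj₂ (refl , refl)) col = colored-sym col

-- Each of the three perfect matchings of `K₄` is either untouched or split between the players, so
-- the edge opposite to a legal move of Alice is still uncoloured.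
record Paired (B R : List (Edge 4)) : Set where
  field
    blue⇒red : ∀ {u v x y} → Opposite u v x y → Colored B u v → Colored R x y
    red⇒blue : ∀ {u v x y} → Opposite u v x y → Colored R u v → Colored B x y
    disjoint : ∀ {u v} → Colored B u v → ¬ Colored R u v

-- The outer edges of a P₄ are opposite, so Alice never owns both of them.
module OppositeReply {B R : List (Edge 4)} {u v x y : Fin 4}
  (paired : Paired B R) (free : Uncolored B R u v) (opp : Opposite x y u v) where

  open Paired paired
  ¬blue : ¬ Colored B u v
  ¬blue = proj₁ (proj₂ free)
  ¬red : ¬ Colored R u v
  ¬red = proj₂ (proj₂ free)
  opp′ : Opposite u v x y
  opp′ = opposite-sym opp
  ¬blue-xy : ¬ Colored B x y
  ¬blue-xy = ¬red ∘ blue⇒red opp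
  ¬red-xy : ¬ Colored R x y
  ¬red-xy = ¬blue ∘ red⇒blue opp
  -- An older blue edge has a red opposite, which is neither `uv`, uncoloured until now, nor an
  -- older blue edge. Two copies of `uv` are not opposite.
  ¬both : ∀ {s t s′ t′} → Opposite s t s′ t′ → Colored ((u , v) ∷ B) s t → ¬ Colored ((u , v) ∷ B) s′ t′
  ¬both o st s′t′ with colored-∷⁻ st | colored-∷⁻ s′t′
  ... | inj₁ ≈uv  | inj₁ ≈uv′  = opposite-disjoint o (≈-common ≈uv ≈uv′)
  ... | inj₁ ≈uv  | inj₂ blue′ = ¬red (colored-resp-≈ ≈uv (blue⇒red (opposite-sym o) blue′))
  ... | inj₂ blue | inj₁ ≈uv′  = ¬red (colored-resp-≈ ≈uv′ (blue⇒red o blue))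
  ... | inj₂ blue | inj₂ blue′ = disjoint blue′ (blue⇒red o blue)
  paired′ : Paired ((u , v) ∷ B) ((x , y) ∷ R)
  paired′ = record
    { blue⇒red = λ o → either (colored-here ∘ opposite-unique opp′ o) (colored-there ∘ blue⇒red o) ∘ colored-∷⁻
    ; red⇒blue = λ o → either (colored-here ∘ opposite-unique opp o) (colored-there ∘ red⇒blue o) ∘ colored-∷⁻
    ; disjoint = λ blue red → either
        (λ ≈uv → either (λ ≈xy → opposite-disjoint opp′ (≈-common (≈-sym ≈uv) (≈-sym ≈xy)))
                       (λ red → ¬red (colored-resp-≈ ≈uv red)) (colored-∷⁻ red))
        (λ blue → either (λ ≈xy → ¬blue-xy (colored-resp-≈ ≈xy blue)) (disjoint blue) (colored-∷⁻ red))
        (colored-∷⁻ blue)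
    }
  ¬copy : ¬ HasCopy (Path 4) ((u , v) ∷ B)
  ¬copy (f , f-inj , adj) =
    ¬both (Unique.map⁺ f-inj (Unique.allFin⁺ 4))
      (adj zero (suc zero) (inj₁ refl)) (adj (suc (suc zero)) (suc (suc (suc zero))) (inj₁ refl))
  free′ : Uncolored ((u , v) ∷ B) R x y
  free′ = opposite-≢ opp , either (opposite-disjoint opp) ¬blue-xy ∘ colored-∷⁻ , ¬red-xy

opposite-reply : Paired B R → Uncolored B R u v → ¬ HasCopy (Path 4) ((u , v) ∷ B) ×
                 (∃₂ λ x y → Uncolored ((u , v) ∷ B) R x y × Paired ((u , v) ∷ B) ((x , y) ∷ R))
opposite-reply paired free =
  let x , y , opp = opposite-exists (proj₁ free); open OppositeReply paired free opp
  in ¬copy , x , y , free′ , paired′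

-- The strategy tree is well founded, so following Bob's opposite replies through it must end at a
-- winning move of Alice, and the invariant rules out every such move.
paired⇒¬wins : Paired B R → ¬ AliceWins (Path 4) B R
paired⇒¬wins paired (move u v free (inj₁ copy)) = proj₁ (opposite-reply paired free) copy
paired⇒¬wins paired (move u v free (inj₂ (_ , next))) =
  let x , y , free′ , paired′ = proj₂ (opposite-reply paired free)
  in paired⇒¬wins paired′ (proj₂ (next x y free′))

¬wins-P₄-on-K₄ : ¬ AliceWinsOn (Path 4) 4
¬wins-P₄-on-K₄ = paired⇒¬wins record
  { blue⇒red = λ _ → λ { (inj₁ ()) ; (inj₂ ()) }
  ; red⇒blue = λ _ → λ { (inj₁ ()) ; (inj₂ ()) }
  ; disjoint = λ col → contradiction col ¬colored-[]
  }

theorem5 : AchievementNumberIs (Path 3) 3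
    × AchievementNumberIs (Path 4) 5
    × (∀ n → 5 ≤ n → AchievementNumberIs (Path n) n)
theorem5 = (wins-P₃-on-K₃ , λ N → ¬wins-small)
         , (wins-P₄-on-K₅ , below-5)
         , λ n 5≤n → let k , n≡ = ≤⇒∃ 5≤n in
             subst (λ n → AliceWinsOn (Path n) n) n≡ (wins-≥5 k) , λ N → ¬wins-small
  where
  ≤⇒∃ : 5 ≤ n → ∃ λ k → 5 + k ≡ n
  ≤⇒∃ 5≤n = _ , m+[n∸m]≡n 5≤n
  below-5 : ∀ N → N < 5 → ¬ AliceWinsOn (Path 4) N
  below-5 N (s≤s N≤4) with m≤n⇒m<n∨m≡n N≤4
  ... | inj₁ N<4  = ¬wins-small N<4
  ... | inj₂ refl = ¬wins-P₄-on-K₄
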